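{- For $i=1,2$ let $G_i$ be an $r_i$-regular graph with $n_i$ vertices. (a) If both $G_1$ and $G_2$ admit balanced labellings and $r_1r_2+r_1+r_2$ is coprime to $n_1n_2$, then $G_1\boxtimes G_2$ is $\mathbb{Z}_{n_1n_2}$-distance antimagic. (b) If $G_1$ is $\mathbb{Z}_{n_1}$-distance magic, $G_2$ is $\mathbb{Z}_{n_2}$-distance magic, $\gcd(r_1,n_2)=1$ and $\gcd(r_2,n_1)=1$, then $G_1\boxtimes G_2$ is $\mathbb{Z}_{n_1n_2}$-distance antimagic.
   Context: The strong product $G_1\boxtimes G_2$ has vertex set $V(G_1)\times V(G_2)$, with distinct $(x_1,x_2),(y_1,y_2)$ adjacent iff for each $i$ either $x_i=y_i$ or $x_iy_i\in E(G_i)$. For an $r$-regular graph $G$ with $n$ vertices, a balanced labelling is a bijection $f:V(G)\to\mathbb{Z}_n$ with $\sum_{y\in N(x)}f(y)\equiv rf(x)\pmod n$ for all $x$ ($N(x)$ the open neighbourhood). For a graph $G$ with $n$ vertices and a bijection $f:V(G)\to\mathbb{Z}_n$, the weight is $w_f(x)=\sum_{y\in N(x)} f(y)$ mod $n$; $f$ is $\mathbb{Z}_n$-distance antimagic if the weights are pairwise distinct, and $\mathbb{Z}_n$-distance magic if all weights are equal. $G$ is $\mathbb{Z}_n$-distance antimagic (resp. magic) if it admits such a labelling. -}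

module Defs where

open import Data.Fin.Base using (Fin; toℕ)
open import Data.Fin.Properties using (nonZeroIndex; inj⇒≟; *↔×)
open import Data.List.Base using (List; allFin; filter; length; map)
open import Data.Nat.Base using (ℕ; _*_)
open import Data.Nat.DivMod using (_mod_)
open import Data.Nat.ListAction using (sum)
open import Data.Product.Base using (∃-syntax; _×_; _,_; proj₁; proj₂)
open import Data.Product.Function.NonDependent.Propositional using (_×-↔_)
open import Data.Sum.Base as Sum using (_⊎_)
open import Function.Base using (_∘_)
open import Function.Bundles using (_↔_; _⤖_; module Inverse; module Bijection)
open import Function.Construct.Composition using (_↔-∘_)
open import Function.Construct.Symmetry using (↔-sym)
open import Function.Definitions using (Injective)
open import Function.Properties.Inverse using (↔⇒↣)
open import Level using (0ℓ)
open import Relation.Binary.Core using (Rel)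
open import Relation.Binary.Definitions
  using (Decidable; DecidableEquality; Irreflexive; Symmetric)
open import Relation.Binary.PropositionalEquality.Core
  using (_≡_; _≢_; refl; sym; ≢-sym)
open import Relation.Nullary.Decidable using (_×-dec_; _⊎-dec_; ¬?)

------------------------------------------------------------------------
-- Finite simple graphs with n vertices

record Graph (n : ℕ) : Set₁ where
  field
    V          : Set
    enum       : V ↔ Fin n
    Adj        : Rel V 0ℓ
    adj?       : Decidable Adj
    adj-sym    : Symmetric Adj
    adj-irrefl : Irreflexive _≡_ Adj

  _≟_ : DecidableEquality V
  _≟_ = inj⇒≟ (↔⇒↣ enum)

  vertices : List V
  vertices = map (Inverse.from enum) (allFin n)

  -- The open neighbourhood N(x), each neighbour being listed exactly once.
  neighbours : V → List V
  neighbours x = filter (adj? x) vertices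

  degree : V → ℕ
  degree x = length (neighbours x)

Regular : ∀ {n} → Graph n → ℕ → Set
Regular G r = ∀ x → Graph.degree G x ≡ r

------------------------------------------------------------------------
-- The strong product

infixr 7 _⊠_

_⊠_ : ∀ {n₁ n₂} → Graph n₁ → Graph n₂ → Graph (n₁ * n₂)
_⊠_ {n₁} {n₂} G₁ G₂ = record
  { V          = G₁.V × G₂.V
  ; enum       = enum
  ; Adj        = λ x y → x ≢ y
                       × (proj₁ x ≡ proj₁ y ⊎ G₁.Adj (proj₁ x) (proj₁ y))
                       × (proj₂ x ≡ proj₂ y ⊎ G₂.Adj (proj₂ x) (proj₂ y))
  ; adj?       = λ x y → ¬? (inj⇒≟ (↔⇒↣ enum) x y)
                   ×-dec (proj₁ x G₁.≟ proj₁ y ⊎-dec G₁.adj? (proj₁ x) (proj₁ y))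
                   ×-dec (proj₂ x G₂.≟ proj₂ y ⊎-dec G₂.adj? (proj₂ x) (proj₂ y))
  ; adj-sym    = λ (x≢y , p , q) →
                   ≢-sym x≢y , Sum.map sym G₁.adj-sym p , Sum.map sym G₂.adj-sym q
  ; adj-irrefl = λ x≡y (x≢y , _) → x≢y x≡y
  }
  where
  module G₁ = Graph G₁
  module G₂ = Graph G₂

  enum : (G₁.V × G₂.V) ↔ Fin (n₁ * n₂)
  enum = ↔-sym *↔× ↔-∘ (G₁.enum ×-↔ G₂.enum)

------------------------------------------------------------------------
-- Labellings by ℤₙ
--
-- ℤₙ is represented by Fin n (the residues 0, …, n-1): a computation in ℤₙ
-- is carried out in ℕ on representatives and then reduced by _mod_.  The
-- modulus is nonzero because a label, an element of Fin n, is at hand.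

module _ {n : ℕ} (G : Graph n) where
  open Graph G

  Labelling : Set
  Labelling = V ⤖ Fin n

  weight : Labelling → V → Fin n
  weight f x = (sum (map (toℕ ∘ to) (neighbours x)) mod n) {{nonZeroIndex (to x)}}
    where open Bijection f using (to)

  -- Meant for r-regular G.
  IsBalanced : ℕ → Labelling → Set
  IsBalanced r f = ∀ x → weight f x ≡ ((r * toℕ (to x)) mod n) {{nonZeroIndex (to x)}}
    where open Bijection f using (to)

  HasBalancedLabelling : ℕ → Set
  HasBalancedLabelling r = ∃[ f ] IsBalanced r f

  IsDistanceAntimagic : Labelling → Set
  IsDistanceAntimagic f = Injective _≡_ _≡_ (weight f)

  IsDistanceMagic : Labelling → Set
  IsDistanceMagic f = ∀ x y → weight f x ≡ weight f y

  DistanceAntimagic : Set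
  DistanceAntimagic = ∃[ f ] IsDistanceAntimagic f

  DistanceMagic : Set
  DistanceMagic = ∃[ f ] IsDistanceMagic f

{-# OPTIONS --safe #-}

-- Label (x , y) by n₂ * f₁ x + f₂ y, where f₁ and f₂ are the given labellings.
-- Summing over the product of the closed neighbourhoods and removing (x , y)
-- itself, the weight is n₂ * p₁ x + p₂ y, where, with Sᵢ the neighbour sums of fᵢ,
--   p₁ = (1 + r₂) * S₁ + r₂ * f₁,   p₂ = (1 + r₁) * S₂ + r₁ * f₂.
-- Reducing it mod n₂ and then cancelling n₂ shows that it determines (x , y) mod
-- n₁ * n₂ as soon as each pᵢ is injective mod nᵢ.  In the balanced case pᵢ is
-- (r₁ * r₂ + r₁ + r₂) * fᵢ mod nᵢ; in the magic case it is a constant plus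
-- r₂ * f₁, respectively r₁ * f₂.
module Submission where

open import Defs
open import Data.Fin.Base using (Fin; toℕ)
open import Data.Fin.Properties
  using (nonZeroIndex; toℕ-injective; toℕ-fromℕ<; toℕ<n; toℕ-combine; *↔×)
open import Data.List.Base using (List; []; _∷_; _++_; length; map; cartesianProduct)
open import Data.List.Membership.Propositional using (_∈_)
open import Data.List.Membership.Propositional.Properties
  using (∈-allFin; ∈-map⁺; ∈-filter⁺; ∈-filter⁻; ∈-cartesianProduct⁺; ∈-cartesianProduct⁻)
open import Data.List.Membership.Propositional.Properties.WithK using (unique∧set⇒bag)
open import Data.List.Properties using (map-++; map-∘; map-cong)
open import Data.List.Relation.Binary.BagAndSetEquality using (∼bag⇒↭)
open import Data.List.Relation.Binary.Permutation.Propositional using (_↭_)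
import Data.List.Relation.Binary.Permutation.Propositional.Properties as ↭
open import Data.List.Relation.Unary.All.Properties using (¬Any⇒All¬)
open import Data.List.Relation.Unary.AllPairs using (_∷_)
open import Data.List.Relation.Unary.Any using (here; there)
open import Data.List.Relation.Unary.Unique.Propositional using (Unique)
import Data.List.Relation.Unary.Unique.Propositional.Properties as Unique
open import Data.Nat.Base using (ℕ; _+_; _*_; _∸_; _≤_; ∣_-_∣; NonZero)
open import Data.Nat.Coprimality as Coprimality
  using (Coprime; coprime-divisor; gcd≡1⇒coprime)
open import Data.Nat.DivMod
open import Data.Nat.Divisibility
  using (_∣_; divides; ∣m⇒∣m*n; ∣n⇒∣m*n; m∣m*n; n∣m*n; *-cancelˡ-∣)
open import Data.Nat.GCD using (gcd)
open import Data.Nat.ListAction using (sum)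
open import Data.Nat.ListAction.Properties using (sum-++; sum-↭)
open import Data.Nat.Properties
open import Data.Nat.Tactic.RingSolver using (solve-∀)
open import Data.Product.Base using (_×_; _,_; proj₂)
open import Data.Product.Function.NonDependent.Propositional using (_×-⤖_)
open import Data.Sum.Base using (_⊎_; inj₁; inj₂)
open import Function.Base using (_∘_)
open import Function.Bundles using (_⇔_; mk⇔; module Equivalence; module Inverse; module Bijection)
open import Function.Construct.Composition using (_⤖-∘_)
open import Function.Construct.Symmetry using (↔-sym)
open import Function.Properties.Inverse using (↔⇒⤖)
open import Relation.Binary.PropositionalEquality
  using (_≡_; refl; sym; trans; cong; cong₂; subst; module ≡-Reasoning)
open import Relation.Nullary.Decidable using (yes; no)

-- Congruences

module _ {n : ℕ} .{{_ : NonZero n}} where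

  %-cong-+ : ∀ {a b c d} → a % n ≡ b % n → c % n ≡ d % n → (a + c) % n ≡ (b + d) % n
  %-cong-+ {a} {b} {c} {d} p q = begin
    (a + c) % n          ≡⟨ %-distribˡ-+ a c n ⟩
    (a % n + c % n) % n  ≡⟨ cong₂ (λ u v → (u + v) % n) p q ⟩
    (b % n + d % n) % n  ≡⟨ %-distribˡ-+ b d n ⟨
    (b + d) % n          ∎
    where open ≡-Reasoning

  %-cong-*ˡ : ∀ k {a b} → a % n ≡ b % n → (k * a) % n ≡ (k * b) % n
  %-cong-*ˡ k {a} {b} p = begin
    (k * a) % n              ≡⟨ %-distribˡ-* k a n ⟩
    ((k % n) * (a % n)) % n  ≡⟨ cong (λ u → ((k % n) * u) % n) p ⟩
    ((k % n) * (b % n)) % n  ≡⟨ %-distribˡ-* k b n ⟨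
    (k * b) % n              ∎
    where open ≡-Reasoning

  -- Stating congruence as divisibility of `∣ a - b ∣` avoids truncated subtraction and turns
  -- cancellation into facts about divisors. Equal remainders cancel, so the difference of the
  -- quotients is the cofactor.
  %≡⇒∣ : ∀ a b → a % n ≡ b % n → n ∣ ∣ a - b ∣
  %≡⇒∣ a b p = divides ∣ a / n - b / n ∣ (begin
    ∣ a - b ∣                                          ≡⟨ cong₂ ∣_-_∣ (m≡m%n+[m/n]*n a n) (m≡m%n+[m/n]*n b n) ⟩
    ∣ a % n + (a / n) * n - (b % n + (b / n) * n) ∣    ≡⟨ cong (λ u → ∣ u + (a / n) * n - (b % n + (b / n) * n) ∣) p ⟩
    ∣ b % n + (a / n) * n - (b % n + (b / n) * n) ∣    ≡⟨ ∣m+n-m+o∣≡∣n-o∣ (b % n) _ _ ⟩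
    ∣ (a / n) * n - (b / n) * n ∣                      ≡⟨ *-distribʳ-∣-∣ n (a / n) (b / n) ⟨
    ∣ a / n - b / n ∣ * n                              ∎)
    where open ≡-Reasoning

  ≤∧∣⇒%≡ : ∀ {a b} → a ≤ b → n ∣ ∣ a - b ∣ → a % n ≡ b % n
  ≤∧∣⇒%≡ {a} {b} a≤b (divides q eq) = begin
    a % n              ≡⟨ [m+kn]%n≡m%n a q n ⟨
    (a + q * n) % n    ≡⟨ cong (λ u → (a + u) % n) (trans (sym eq) (m≤n⇒∣m-n∣≡n∸m a≤b)) ⟩
    (a + (b ∸ a)) % n  ≡⟨ cong (_% n) (m+[n∸m]≡n a≤b) ⟩
    b % n              ∎
    where open ≡-Reasoning

  ∣⇒%≡ : ∀ a b → n ∣ ∣ a - b ∣ → a % n ≡ b % n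
  ∣⇒%≡ a b d with ≤-total a b
  ... | inj₁ a≤b = ≤∧∣⇒%≡ a≤b d
  ... | inj₂ b≤a = sym (≤∧∣⇒%≡ b≤a (subst (n ∣_) (∣-∣-comm a b) d))

  %-cancelˡ-+ : ∀ c a b → (c + a) % n ≡ (c + b) % n → a % n ≡ b % n
  %-cancelˡ-+ c a b p = ∣⇒%≡ a b (subst (n ∣_) (∣m+n-m+o∣≡∣n-o∣ c a b) (%≡⇒∣ (c + a) (c + b) p))

  -- By Euclid's lemma: `n` divides `k * ∣ a - b ∣` and is coprime to `k`, hence divides
  -- `∣ a - b ∣`.
  %-cancelˡ-* : ∀ {k} a b → Coprime k n → (k * a) % n ≡ (k * b) % n → a % n ≡ b % n
  %-cancelˡ-* {k} a b coprime p = ∣⇒%≡ a b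
    (coprime-divisor (Coprimality.sym coprime)
      (subst (n ∣_) (sym (*-distribˡ-∣-∣ k a b)) (%≡⇒∣ (k * a) (k * b) p)))

  toℕ-mod : ∀ a → toℕ (a mod n) ≡ a % n
  toℕ-mod a = toℕ-fromℕ< (m%n<n a n)

  mod≡⇒%≡ : ∀ a b → a mod n ≡ b mod n → a % n ≡ b % n
  mod≡⇒%≡ a b p = trans (sym (toℕ-mod a)) (trans (cong toℕ p) (toℕ-mod b))

module _ {m n : ℕ} .{{_ : NonZero m}} .{{_ : NonZero n}} .{{_ : NonZero (m * n)}} where

  -- Since `n` divides `m * n`, the congruence may be reduced further mod `n`, where the multiples
  -- of `n` vanish.
  %-remainder : ∀ {a b} c d → (n * a + c) % (m * n) ≡ (n * b + d) % (m * n) → c % n ≡ d % n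
  %-remainder {a} {b} c d p = begin
    c % n                          ≡⟨ %-remove-+ˡ c (m∣m*n a) ⟨
    (n * a + c) % n                ≡⟨ m∣n⇒o%n%m≡o%m n (m * n) (n * a + c) (n∣m*n m) ⟨
    (n * a + c) % (m * n) % n      ≡⟨ cong (_% n) p ⟩
    (n * b + d) % (m * n) % n      ≡⟨ m∣n⇒o%n%m≡o%m n (m * n) (n * b + d) (n∣m*n m) ⟩
    (n * b + d) % n                ≡⟨ %-remove-+ˡ d (m∣m*n b) ⟩
    d % n                          ∎
    where open ≡-Reasoning

  %-cancelˡ-*-modulus : ∀ a b → (n * a) % (m * n) ≡ (n * b) % (m * n) → a % m ≡ b % m
  %-cancelˡ-*-modulus a b p = ∣⇒%≡ a b (*-cancelˡ-∣ n
    (subst (_∣ n * ∣ a - b ∣) (*-comm m n)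
      (subst (m * n ∣_) (sym (*-distribˡ-∣-∣ n a b)) (%≡⇒∣ (n * a) (n * b) p))))

toℕ-injective-% : ∀ {n} .{{_ : NonZero n}} (i j : Fin n) → toℕ i % n ≡ toℕ j % n → i ≡ j
toℕ-injective-% i j p = toℕ-injective
  (trans (sym (m<n⇒m%n≡m (toℕ<n i))) (trans p (m<n⇒m%n≡m (toℕ<n j))))

-- Sums over neighbourhoods

sum-map-const-+ : ∀ {B : Set} c (h : B → ℕ) ys →
  sum (map (λ y → c + h y) ys) ≡ length ys * c + sum (map h ys)
sum-map-const-+ c h []       = refl
sum-map-const-+ c h (y ∷ ys) rewrite sum-map-const-+ c h ys =
  rearrange c (h y) (length ys * c) (sum (map h ys))
  where
  rearrange : ∀ c d e s → c + d + (e + s) ≡ c + e + (d + s)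
  rearrange = solve-∀

-- Each `g x` is met once for every element of `ys`, and each `h y` once for every element of `xs`.
sum-cartesianProduct : ∀ {A B : Set} c (g : A → ℕ) (h : B → ℕ) xs ys →
  sum (map (λ (x , y) → c * g x + h y) (cartesianProduct xs ys))
    ≡ c * (length ys * sum (map g xs)) + length xs * sum (map h ys)
sum-cartesianProduct c g h []       ys = base c (length ys)
  where
  base : ∀ c l → 0 ≡ c * (l * 0) + 0
  base = solve-∀
sum-cartesianProduct {A} {B} c g h (x ∷ xs) ys = begin
  sum (map k (map (x ,_) ys ++ cartesianProduct xs ys))
    ≡⟨ cong sum (map-++ k (map (x ,_) ys) _) ⟩
  sum (map k (map (x ,_) ys) ++ map k (cartesianProduct xs ys))
    ≡⟨ sum-++ (map k (map (x ,_) ys)) _ ⟩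
  sum (map k (map (x ,_) ys)) + sum (map k (cartesianProduct xs ys))
    ≡⟨ cong₂ _+_ (trans (cong sum (sym (map-∘ ys))) (sum-map-const-+ (c * g x) h ys))
                 (sum-cartesianProduct c g h xs ys) ⟩
  length ys * (c * g x) + sum (map h ys)
    + (c * (length ys * sum (map g xs)) + length xs * sum (map h ys))
    ≡⟨ rearrange c (g x) (length ys) (sum (map g xs)) (length xs) (sum (map h ys)) ⟩
  c * (length ys * (g x + sum (map g xs))) + (sum (map h ys) + length xs * sum (map h ys)) ∎
  where
  open ≡-Reasoning
  k : A × B → ℕ
  k (x , y) = c * g x + h y
  rearrange : ∀ c u l s m t → l * (c * u) + t + (c * (l * s) + m * t) ≡ c * (l * (u + s)) + (t + m * t)
  rearrange = solve-∀

module _ {n : ℕ} (G : Graph n) where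
  open Graph G

  -- Closed neighbourhoods are the convenient objects here: in a strong product they are products of
  -- closed neighbourhoods, whereas open ones do not factor.
  closedNeighbours : V → List V
  closedNeighbours x = x ∷ neighbours x

  neighbourSum : (V → ℕ) → V → ℕ
  neighbourSum h x = sum (map h (neighbours x))

  ∈-vertices : ∀ x → x ∈ vertices
  ∈-vertices x = subst (_∈ vertices) (Inverse.strictlyInverseʳ enum x)
    (∈-map⁺ (Inverse.from enum) (∈-allFin (Inverse.to enum x)))

  ∈-neighbours⁺ : ∀ {x y} → Adj x y → y ∈ neighbours x
  ∈-neighbours⁺ {x} {y} xy = ∈-filter⁺ (adj? x) (∈-vertices y) xy

  ∈-neighbours⁻ : ∀ {x y} → y ∈ neighbours x → Adj x y
  ∈-neighbours⁻ {x} p = proj₂ (∈-filter⁻ (adj? x) {xs = vertices} p)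

  ∈-closedNeighbours : ∀ {x y} → y ∈ closedNeighbours x ⇔ (x ≡ y ⊎ Adj x y)
  ∈-closedNeighbours = mk⇔
    (λ { (here refl) → inj₁ refl ; (there p) → inj₂ (∈-neighbours⁻ p) })
    (λ { (inj₁ refl) → here refl ; (inj₂ xy) → there (∈-neighbours⁺ xy) })

  closedNeighbours-unique : ∀ x → Unique (closedNeighbours x)
  closedNeighbours-unique x =
    ¬Any⇒All¬ _ (λ x∈N → adj-irrefl refl (∈-neighbours⁻ x∈N))
    ∷ Unique.filter⁺ (adj? x) (Unique.map⁺ from-injective (Unique.allFin⁺ n))
    where
    from-injective : ∀ {i j} → Inverse.from enum i ≡ Inverse.from enum j → i ≡ j
    from-injective {i} {j} p = trans (sym (Inverse.strictlyInverseˡ enum i))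
      (trans (cong (Inverse.to enum) p) (Inverse.strictlyInverseˡ enum j))

-- Neighbourhoods in the strong product

module _ {n₁ n₂ : ℕ} (G₁ : Graph n₁) (G₂ : Graph n₂) where
  private
    module G₁ = Graph G₁
    module G₂ = Graph G₂

  -- The two lists may be ordered differently, but neither has repetitions, so equal membership
  -- already makes them permutations of each other, which is enough for sums.
  closedNeighbours-⊠ : ∀ x y →
    closedNeighbours (G₁ ⊠ G₂) (x , y)
      ↭ cartesianProduct (closedNeighbours G₁ x) (closedNeighbours G₂ y)
  closedNeighbours-⊠ x y = ∼bag⇒↭ (unique∧set⇒bag
    (closedNeighbours-unique (G₁ ⊠ G₂) (x , y))
    (Unique.cartesianProduct⁺ (closedNeighbours-unique G₁ x) (closedNeighbours-unique G₂ y))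
    (mk⇔ (to ∘ Equivalence.to (∈-closedNeighbours (G₁ ⊠ G₂)))
         (Equivalence.from (∈-closedNeighbours (G₁ ⊠ G₂)) ∘ from)))
    where
    N₁ = closedNeighbours G₁ x
    N₂ = closedNeighbours G₂ y

    to : ∀ {z} → (x , y) ≡ z ⊎ Graph.Adj (G₁ ⊠ G₂) (x , y) z → z ∈ cartesianProduct N₁ N₂
    to (inj₁ refl) = ∈-cartesianProduct⁺ {xs = N₁} {ys = N₂} (here refl) (here refl)
    to (inj₂ (_ , p , q)) = ∈-cartesianProduct⁺
      (Equivalence.from (∈-closedNeighbours G₁) p) (Equivalence.from (∈-closedNeighbours G₂) q)

    from : ∀ {z} → z ∈ cartesianProduct N₁ N₂ → (x , y) ≡ z ⊎ Graph.Adj (G₁ ⊠ G₂) (x , y) z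
    -- Adjacency in the product includes distinctness, so the pair `z = (x , y)` has to be split off
    -- first.
    from {z} z∈ with Graph._≟_ (G₁ ⊠ G₂) (x , y) z | ∈-cartesianProduct⁻ N₁ N₂ z∈
    ... | yes eq | _     = inj₁ eq
    ... | no neq | p , q = inj₂ (neq , Equivalence.to (∈-closedNeighbours G₁) p
                                     , Equivalence.to (∈-closedNeighbours G₂) q)

  neighbourSum-⊠ : ∀ {r₁ r₂} → Regular G₁ r₁ → Regular G₂ r₂ →
    ∀ c (g : G₁.V → ℕ) (h : G₂.V → ℕ) x y →
    neighbourSum (G₁ ⊠ G₂) (λ (u , v) → c * g u + h v) (x , y)
      ≡ c * ((1 + r₂) * neighbourSum G₁ g x + r₂ * g x)
        + ((1 + r₁) * neighbourSum G₂ h y + r₁ * h y)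
  -- Adding the term of `(x , y)` to both sides turns the left one, by definition, into the sum over
  -- the closed neighbourhood, so nothing is ever subtracted in ℕ.
  neighbourSum-⊠ {r₁} {r₂} reg₁ reg₂ c g h x y = +-cancelˡ-≡ (c * g x + h y) _ _ (begin
    sum (map k (closedNeighbours (G₁ ⊠ G₂) (x , y)))
      ≡⟨ sum-↭ (↭.map⁺ k (closedNeighbours-⊠ x y)) ⟩
    sum (map k (cartesianProduct (closedNeighbours G₁ x) (closedNeighbours G₂ y)))
      ≡⟨ sum-cartesianProduct c g h (closedNeighbours G₁ x) (closedNeighbours G₂ y) ⟩
    c * ((1 + G₂.degree y) * (g x + S₁)) + (1 + G₁.degree x) * (h y + S₂)
      ≡⟨ cong₂ (λ d₂ d₁ → c * ((1 + d₂) * (g x + S₁)) + (1 + d₁) * (h y + S₂)) (reg₂ y) (reg₁ x) ⟩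
    c * ((1 + r₂) * (g x + S₁)) + (1 + r₁) * (h y + S₂)
      ≡⟨ rearrange c (g x) (h y) S₁ S₂ r₁ r₂ ⟩
    c * g x + h y + (c * ((1 + r₂) * S₁ + r₂ * g x) + ((1 + r₁) * S₂ + r₁ * h y)) ∎)
    where
    open ≡-Reasoning
    k : G₁.V × G₂.V → ℕ
    k (u , v) = c * g u + h v
    S₁ = neighbourSum G₁ g x
    S₂ = neighbourSum G₂ h y
    rearrange : ∀ c a b s t r₁ r₂ →
      c * ((1 + r₂) * (a + s)) + (1 + r₁) * (b + t)
        ≡ c * a + b + (c * ((1 + r₂) * s + r₂ * a) + ((1 + r₁) * t + r₁ * b))
    rearrange = solve-∀

-- Labellings

module _ {n : ℕ} (G : Graph n) (f : Labelling G) where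
  open Graph G
  open Bijection f using (to; injective)

  label : V → ℕ
  label = toℕ ∘ to

  -- p₁ or p₂ of the header; d is the degree of the other factor.
  coordinateWeight : ℕ → V → ℕ
  coordinateWeight d x = (1 + d) * neighbourSum G label x + d * label x

  -- The instance is quantified inside because an empty graph is allowed: `n` is known to be nonzero
  -- only once a vertex is at hand.
  InjectiveMod : (V → ℕ) → Set
  InjectiveMod p = .{{_ : NonZero n}} → ∀ {x y} → p x % n ≡ p y % n → x ≡ y

  -- The factor `k` cancels mod `n`; labels lie below `n`, so congruent labels are equal, and the
  -- labelling is injective.
  coprime⇒injectiveMod : ∀ {k} → Coprime k n → InjectiveMod (λ x → k * label x)
  coprime⇒injectiveMod coprime {x} {y} p =
    injective (toℕ-injective-% (to x) (to y) (%-cancelˡ-* (label x) (label y) coprime p))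

  -- Balance replaces the neighbour sum by `r * label x` mod `n`, which makes the whole expression a
  -- single multiple of the label.
  balanced⇒coordinateWeight-injective : ∀ r d → IsBalanced G r f →
    Coprime (r + d + r * d) n → InjectiveMod (coordinateWeight d)
  balanced⇒coordinateWeight-injective r d balanced coprime {x} {y} p =
    coprime⇒injectiveMod coprime (trans (sym (reduce x)) (trans p (reduce y)))
    where
    rearrange : ∀ r d l → (1 + d) * (r * l) + d * l ≡ (r + d + r * d) * l
    rearrange = solve-∀
    balanced-% : .{{_ : NonZero n}} → ∀ x → neighbourSum G label x % n ≡ (r * label x) % n
    balanced-% x = mod≡⇒%≡ {{nonZeroIndex (to x)}} (neighbourSum G label x) (r * label x) (balanced x)
    reduce : .{{_ : NonZero n}} → ∀ x → coordinateWeight d x % n ≡ ((r + d + r * d) * label x) % n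
    reduce x = trans
      (%-cong-+ (%-cong-*ˡ (1 + d) (balanced-% x)) refl)
      (cong (_% n) (rearrange r d (label x)))

  magic⇒coordinateWeight-injective : ∀ d → IsDistanceMagic G f →
    Coprime d n → InjectiveMod (coordinateWeight d)
  magic⇒coordinateWeight-injective d magic coprime {x} {y} p =
    coprime⇒injectiveMod coprime
      -- The neighbour sum at `x` is exchanged for the congruent one at `y`, so that both sides
      -- share a summand that cancels.
      (%-cancelˡ-+ ((1 + d) * neighbourSum G label y) (d * label x) (d * label y)
        (trans (%-cong-+ (%-cong-*ˡ (1 + d) magic-%) refl) p))
    where
    magic-% : neighbourSum G label y % n ≡ neighbourSum G label x % n
    magic-% = mod≡⇒%≡ {{nonZeroIndex (to x)}} (neighbourSum G label y) (neighbourSum G label x) (magic y x)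

-- The labelling of the strong product

module _ {n₁ n₂ r₁ r₂ : ℕ} (G₁ : Graph n₁) (G₂ : Graph n₂)
         (reg₁ : Regular G₁ r₁) (reg₂ : Regular G₂ r₂)
         (f₁ : Labelling G₁) (f₂ : Labelling G₂) where

  productLabelling : Labelling (G₁ ⊠ G₂)
  productLabelling = ↔⇒⤖ (↔-sym *↔×) ⤖-∘ (f₁ ×-⤖ f₂)

  antimagic-⊠ : InjectiveMod G₁ f₁ (coordinateWeight G₁ f₁ r₂) →
                InjectiveMod G₂ f₂ (coordinateWeight G₂ f₂ r₁) →
                DistanceAntimagic (G₁ ⊠ G₂)
  antimagic-⊠ p₁-injective p₂-injective = productLabelling , λ {z} {w} → injective z w
    where
    p₁ = coordinateWeight G₁ f₁ r₂
    p₂ = coordinateWeight G₂ f₂ r₁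
    S  = neighbourSum (G₁ ⊠ G₂) (label (G₁ ⊠ G₂) productLabelling)

    total : ∀ x y → S (x , y) ≡ n₂ * p₁ x + p₂ y
    total x y = trans
      (cong sum (map-cong (λ (u , v) → toℕ-combine (Bijection.to f₁ u) (Bijection.to f₂ v))
                          (Graph.neighbours (G₁ ⊠ G₂) (x , y))))
      (neighbourSum-⊠ G₁ G₂ reg₁ reg₂ n₂ (label G₁ f₁) (label G₂ f₂) x y)

    injective : ∀ z w → weight (G₁ ⊠ G₂) productLabelling z ≡ weight (G₁ ⊠ G₂) productLabelling w → z ≡ w
    injective z@(x , y) w@(x′ , y′) eq = conclude y≡y′
      where
      -- The labels of `x` and `y` witness that `Fin n₁` and `Fin n₂` are inhabited, so all three
      -- moduli are nonzero.
      instance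
        n₁≢0 : NonZero n₁
        n₁≢0 = nonZeroIndex (Bijection.to f₁ x)
        n₂≢0 : NonZero n₂
        n₂≢0 = nonZeroIndex (Bijection.to f₂ y)
        n₁n₂≢0 : NonZero (n₁ * n₂)
        n₁n₂≢0 = m*n≢0 n₁ n₂
      S≡ : S z % (n₁ * n₂) ≡ S w % (n₁ * n₂)
      S≡ = mod≡⇒%≡ {{nonZeroIndex (Bijection.to productLabelling z)}} (S z) (S w) eq
      weights≡ : (n₂ * p₁ x + p₂ y) % (n₁ * n₂) ≡ (n₂ * p₁ x′ + p₂ y′) % (n₁ * n₂)
      weights≡ = trans (cong (_% (n₁ * n₂)) (sym (total x y)))
                (trans S≡ (cong (_% (n₁ * n₂)) (total x′ y′)))
      -- The second coordinate comes first: mod `n₂` only `p₂` survives.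
      y≡y′ : y ≡ y′
      y≡y′ = p₂-injective (%-remainder {n₁} (p₂ y) (p₂ y′) weights≡)
      conclude : y ≡ y′ → z ≡ w
      -- With `y` shared, `p₂ y` cancels, and a congruence of multiples of `n₂` mod `n₁ * n₂` is one
      -- of `p₁` mod `n₁`.
      conclude refl = cong (_, y) (p₁-injective (%-cancelˡ-*-modulus {n₁} {n₂} (p₁ x) (p₁ x′)
        (%-cancelˡ-+ (p₂ y) (n₂ * p₁ x) (n₂ * p₁ x′)
          (trans (cong (_% (n₁ * n₂)) (+-comm (p₂ y) _))
          (trans weights≡ (cong (_% (n₁ * n₂)) (+-comm _ (p₂ y))))))))

mainTheorem16 : ∀ {n₁ n₂ r₁ r₂ : ℕ} (G₁ : Graph n₁) (G₂ : Graph n₂) →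
    Regular G₁ r₁ → Regular G₂ r₂ →
    (HasBalancedLabelling G₁ r₁ → HasBalancedLabelling G₂ r₂ →
    Coprime (r₁ * r₂ + r₁ + r₂) (n₁ * n₂) →
    DistanceAntimagic (G₁ ⊠ G₂))
    ×
    (DistanceMagic G₁ → DistanceMagic G₂ →
    gcd r₁ n₂ ≡ 1 → gcd r₂ n₁ ≡ 1 →
    DistanceAntimagic (G₁ ⊠ G₂))
mainTheorem16 {n₁} {n₂} {r₁} {r₂} G₁ G₂ reg₁ reg₂ = balancedCase , magicCase
  where
  balancedCase : HasBalancedLabelling G₁ r₁ → HasBalancedLabelling G₂ r₂ →
    Coprime (r₁ * r₂ + r₁ + r₂) (n₁ * n₂) → DistanceAntimagic (G₁ ⊠ G₂)
  balancedCase (f₁ , balanced₁) (f₂ , balanced₂) coprime =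
    antimagic-⊠ G₁ G₂ reg₁ reg₂ f₁ f₂
      (balanced⇒coordinateWeight-injective G₁ f₁ r₁ r₂ balanced₁
        -- A common divisor with `n₁` also divides `n₁ * n₂`, so coprimality passes to the factor;
        -- likewise for `n₂` below.
        (subst (λ k → Coprime k n₁) (eq₁ r₁ r₂)
          λ (d∣R , d∣n₁) → coprime (d∣R , ∣m⇒∣m*n n₂ d∣n₁)))
      (balanced⇒coordinateWeight-injective G₂ f₂ r₂ r₁ balanced₂
        (subst (λ k → Coprime k n₂) (eq₂ r₁ r₂)
          λ (d∣R , d∣n₂) → coprime (d∣R , ∣n⇒∣m*n n₁ d∣n₂)))
    where
    eq₁ : ∀ r s → r * s + r + s ≡ r + s + r * s
    eq₁ = solve-∀
    eq₂ : ∀ r s → r * s + r + s ≡ s + r + s * r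
    eq₂ = solve-∀

  magicCase : DistanceMagic G₁ → DistanceMagic G₂ →
    gcd r₁ n₂ ≡ 1 → gcd r₂ n₁ ≡ 1 → DistanceAntimagic (G₁ ⊠ G₂)
  magicCase (f₁ , magic₁) (f₂ , magic₂) gcd₁ gcd₂ =
    antimagic-⊠ G₁ G₂ reg₁ reg₂ f₁ f₂
      -- The conditions are crossed because the label in each factor is multiplied by the degree of
      -- the other factor.
      (magic⇒coordinateWeight-injective G₁ f₁ r₂ magic₁ (gcd≡1⇒coprime gcd₂))
      (magic⇒coordinateWeight-injective G₂ f₂ r₁ magic₂ (gcd≡1⇒coprime gcd₁))
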